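{- There exists an absolute constant $C>0$ such that the following holds. Let $\mathfrak{X}=(\Omega,S)$ be a scheme on $n=|\Omega|$ points, and let $a\in S^\cup$ be a connected relation. Then \[ \overrightarrow{\mathrm{diam}}(a) \leq C\cdot \mathrm{diam}(a)^2(\log n)^2, \] i.e. $\overrightarrow{\mathrm{diam}}(a)=O(\mathrm{diam}(a)^2(\log n)^2)$.
   Context: Let $\Omega$ be a finite set. For a relation $a\subseteq\Omega\times\Omega$ write $a^*=\{(\beta,\alpha)\mid(\alpha,\beta)\in a\}$, and let $1_\Omega=\{(\alpha,\alpha)\mid\alpha\in\Omega\}$. A scheme (homogeneous coherent configuration) is a pair $\mathfrak{X}=(\Omega,S)$ where $S$ is a partition of $\Omega\times\Omega$ into relations such that: (1) $1_\Omega\in S$; (2) if $a\in S$ then $a^*\in S$; (3) for any $a,b,c\in S$ the number $|\{\gamma\in\Omega\mid(\alpha,\gamma)\in b,\ (\gamma,\beta)\in c\}|$ does not depend on the choice of $(\alpha,\beta)\in a$. $S^\cup$ denotes the set of all unions of relations from $S$. Relations on $\Omega$ are viewed as directed graphs on the vertex set $\Omega$. The directed diameter $\overrightarrow{\mathrm{diam}}(a)$ is the maximum over ordered pairs of vertices of the length of a shortest path respecting edge orientations; the undirected diameter is $\mathrm{diam}(a)=\overrightarrow{\mathrm{diam}}(a\cup a^*)$. Connected means that any two vertices are joined by a path ignoring orientations; for $a\in S^\cup$ this is equivalent to strong connectivity, so the directed diameter is finite. $\log$ is the base-2 logarithm. -}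

module Defs where

open import Data.Fin using (Fin)
open import Data.Fin.Subset as Subset using (Subset; _∈_; _∩_; ∣_∣; ⁅_⁆)
open import Data.List using (List; foldr)
open import Data.List.Relation.Unary.All using (All)
open import Data.Nat using (ℕ; zero; suc; _*_; _^_; _≤_; NonZero)
open import Data.Product using (∃₂; ∃-syntax; Σ-syntax; _×_)
open import Data.Vec using (Vec; lookup; replicate; tabulate; transpose; zipWith)
open import Level using (0ℓ)
open import Relation.Binary.Core using (Rel)
open import Relation.Binary.Construct.Closure.Equivalence using (EqClosure)
open import Relation.Binary.Construct.Closure.ReflexiveTransitive using (Star; fold)
open import Relation.Binary.PropositionalEquality using (_≡_)
open import Relation.Unary using (Pred)

private
  variable
    n : ℕ

-- Relations on Ω = Fin n, given by their rows: row α is the set of all β with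
-- (α , β) in the relation.  In this form _≡_ is extensional equality.
Relation : ℕ → Set
Relation n = Vec (Subset n) n

Arc : Relation n → Fin n → Fin n → Set
Arc a α β = β ∈ lookup a α

infix 8 _*ᴿ
_*ᴿ : Relation n → Relation n
a *ᴿ = transpose a

1ᴿ : Relation n
1ᴿ = tabulate ⁅_⁆

∅ᴿ : Relation n
∅ᴿ {n} = replicate n Subset.⊥

infixr 6 _∪ᴿ_
_∪ᴿ_ : Relation n → Relation n → Relation n
_∪ᴿ_ = zipWith Subset._∪_

⋃ᴿ : List (Relation n) → Relation n
⋃ᴿ = foldr _∪ᴿ_ ∅ᴿ

-- |{γ | (α , γ) ∈ b and (γ , β) ∈ c}|; row β of c* is {γ | (γ , β) ∈ c}.
#paths : Relation n → Relation n → Fin n → Fin n → ℕ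
#paths b c α β = ∣ lookup b α ∩ lookup (c *ᴿ) β ∣

-- The classes of a partition are nonempty.  With 1ᴿ-class this forces n ≥ 1.
record Scheme (n : ℕ) : Set₁ where
  field
    S : Pred (Relation n) 0ℓ

    nonempty : ∀ {a} → S a → ∃₂ λ α β → Arc a α β
    cover    : ∀ α β → ∃[ a ] (S a × Arc a α β)
    disjoint : ∀ {a b α β} → S a → S b → Arc a α β → Arc b α β → a ≡ b

    1ᴿ-class  : S 1ᴿ
    *ᴿ-closed : ∀ {a} → S a → S (a *ᴿ)
    coherent  : ∀ {a b c} → S a → S b → S c →
                ∀ {α β α′ β′} → Arc a α β → Arc a α′ β′ →
                #paths b c α β ≡ #paths b c α′ β′

infix 4 _∈_^∪
_∈_^∪ : Relation n → Scheme n → Set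
a ∈ X ^∪ = ∃[ T ] (All (Scheme.S X) T × a ≡ ⋃ᴿ T)

Connected : Relation n → Set
Connected a = ∀ α β → EqClosure (Arc a) α β

length : ∀ {A : Set} {R : Rel A 0ℓ} {x y} → Star R x y → ℕ
length = fold (λ _ _ → ℕ) (λ _ → suc) zero

Shortest : ∀ {A : Set} {R : Rel A 0ℓ} {x y} → Star R x y → Set
Shortest {R = R} {x} {y} p = (q : Star R x y) → length p ≤ length q

Path : Relation n → Fin n → Fin n → Set
Path a = Star (Arc a)

-- D is the maximum, over all ordered pairs of vertices, of the length of a
-- shortest directed path.  At most one D satisfies this, and one exists (n ≥ 1)
-- exactly when the directed diameter is finite.
IsDirectedDiameter : Relation n → ℕ → Set
IsDirectedDiameter a D =
    (∀ α β → Σ[ p ∈ Path a α β ] (Shortest p × length p ≤ D))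
  × (∃₂ λ α β → Σ[ p ∈ Path a α β ] (Shortest p × length p ≡ D))

IsDiameter : Relation n → ℕ → Set
IsDiameter a = IsDirectedDiameter (a ∪ᴿ a *ᴿ)

-- The real inequality x ≤ y · (log₂ n)², for n ≥ 1.  Since n ^ q ≤ 2 ^ p says
-- log₂ n ≤ p / q, and log₂ n ≥ 0 is the infimum of all such fractions p / q,
-- it holds exactly when x ≤ y · (p / q)² for each of them.
infix 4 _≤_·log₂²_
_≤_·log₂²_ : ℕ → ℕ → ℕ → Set
x ≤ y ·log₂² n =
  ∀ p q .{{_ : NonZero q}} → n ^ q ≤ 2 ^ p → x * q ^ 2 ≤ y * p ^ 2

{-# OPTIONS --safe #-}

-- Let b r be the size of the directed ball B(α, r); it does not depend on α,
-- and neither does the size of the in-balls, which is also b r.  For an arc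
-- α → β we have B(β, r) ⊆ B(α, r + 1), so each of B(α, r) and B(β, r) has at
-- most e = b (r + 1) − b r points outside the other.  Hence B(α, r) has at most
-- d e points outside B(β, r) for any α and β, where d is the undirected
-- diameter.  But the average over β of |B(α, r) ∩ B(β, r)| is b r ² / n, so
-- b r ≤ 2 d e as long as b r ≤ n / 2, and the balls double in size every 2 d
-- steps.  After r = 2 d ⌊log n⌋ steps they contain more than half of all the
-- points; then every out-ball meets every in-ball, so the directed diameter is
-- at most 2 r.
module Submission where

open import Defs
open import Algebra.Properties.CommutativeMonoid.Sum as CommutativeMonoidSum using ()
open import Algebra.Properties.Semiring.Sum as SemiringSum using ()
open import Data.Bool using (Bool; true; false; _∧_)
open import Data.Fin using (Fin; zero; suc)
open import Data.Fin.Properties using (nonZeroIndex)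
open import Data.Fin.Subset as Subset using
  (Subset; inside; outside; _∈_; _⊆_; _∩_; _─_; ∣_∣; ⁅_⁆; ⊤; ⊥; Nonempty)
open import Data.Fin.Subset.Properties
open import Data.List using (List; allFin; cartesianProduct)
open import Data.List.Extrema.Nat using (argmax; f[xs]≤f[argmax])
open import Data.List.Membership.Propositional.Properties using (∈-allFin; ∈-cartesianProduct⁺)
open import Data.List.Relation.Unary.All as All using (All)
open import Data.Nat using (ℕ; zero; suc; _+_; _*_; _^_; _∸_; _≤_; _<_; _>_; _≤?_; z≤n; s≤s; >-nonZero; ≢-nonZero)
open import Data.Nat.Properties
open import Data.Nat.Tactic.RingSolver using (solve-∀)
open import Data.Product using (Σ-syntax; ∃₂; ∃-syntax; _×_; _,_; proj₁; proj₂)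
open import Data.Sum using (_⊎_; inj₁; inj₂)
open import Data.Vec using (Vec; []; _∷_; here; there; _⊛_; zipWith; lookup; tabulate; transpose; replicate)
open import Data.Vec.Properties using
  ([]=⇒lookup; lookup⇒[]=; lookup∘tabulate; tabulate∘lookup; tabulate-cong;
   lookup-zipWith; lookup-replicate; lookup-⊛)
open import Function using (_∘_; id)
open import Relation.Binary.Construct.Closure.ReflexiveTransitive using (Star; ε; _◅_; _◅◅_; gmap)
open import Relation.Binary.Construct.Closure.Symmetric using (SymClosure; fwd; bwd)
open import Relation.Binary.PropositionalEquality
open import Relation.Nullary using (¬_; yes; no; does; contradiction)
open import Relation.Nullary.Decidable using (dec-true)

open CommutativeMonoidSum +-0-commutativeMonoid using (sum; sum-cong-≗; ∑-comm)
open SemiringSum +-*-semiring using (*-distribʳ-sum)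

private
  variable
    n : ℕ

-- Sizes of intersections and differences of finite sets.

∣p∣≡∣p∩q∣+∣p─q∣ : (p q : Subset n) → ∣ p ∣ ≡ ∣ p ∩ q ∣ + ∣ p ─ q ∣
∣p∣≡∣p∩q∣+∣p─q∣ []            []            = refl
∣p∣≡∣p∩q∣+∣p─q∣ (outside ∷ p) (outside ∷ q) = ∣p∣≡∣p∩q∣+∣p─q∣ p q
∣p∣≡∣p∩q∣+∣p─q∣ (outside ∷ p) (inside  ∷ q) = ∣p∣≡∣p∩q∣+∣p─q∣ p q
∣p∣≡∣p∩q∣+∣p─q∣ (inside  ∷ p) (inside  ∷ q) = cong suc (∣p∣≡∣p∩q∣+∣p─q∣ p q)
∣p∣≡∣p∩q∣+∣p─q∣ (inside  ∷ p) (outside ∷ q) =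
  trans (cong suc (∣p∣≡∣p∩q∣+∣p─q∣ p q)) (sym (+-suc _ _))

-- `p` and `q ─ p` are disjoint parts of `r`. Later `p` and `q` are two balls of radius r inside one
-- ball of radius r + 1.
∣p∣+∣q─p∣≤∣r∣ : {p q r : Subset n} → p ⊆ r → q ⊆ r → ∣ p ∣ + ∣ q ─ p ∣ ≤ ∣ r ∣
∣p∣+∣q─p∣≤∣r∣ {p = []}          {[]}          {[]}          p⊆r q⊆r = z≤n
∣p∣+∣q─p∣≤∣r∣ {p = inside  ∷ p} {y ∷ q}       {outside ∷ r} p⊆r q⊆r with () ← p⊆r here
∣p∣+∣q─p∣≤∣r∣ {p = outside ∷ p} {inside ∷ q}  {outside ∷ r} p⊆r q⊆r with () ← q⊆r here
∣p∣+∣q─p∣≤∣r∣ {p = inside  ∷ p} {y ∷ q}       {inside ∷ r}  p⊆r q⊆r =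
  s≤s (∣p∣+∣q─p∣≤∣r∣ (drop-∷-⊆ p⊆r) (drop-∷-⊆ q⊆r))
∣p∣+∣q─p∣≤∣r∣ {p = outside ∷ p} {inside ∷ q}  {inside ∷ r}  p⊆r q⊆r =
  ≤-trans (≤-reflexive (+-suc _ _)) (s≤s (∣p∣+∣q─p∣≤∣r∣ (drop-∷-⊆ p⊆r) (drop-∷-⊆ q⊆r)))
∣p∣+∣q─p∣≤∣r∣ {p = outside ∷ p} {outside ∷ q} {z ∷ r}       p⊆r q⊆r =
  ≤-trans (∣p∣+∣q─p∣≤∣r∣ (drop-∷-⊆ p⊆r) (drop-∷-⊆ q⊆r)) (∣p∣≤∣x∷p∣ z r)

-- A point of `p` outside `r` lies either outside `q`, or in `q` and outside `r`. This triangle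
-- inequality is what lets differences of balls add up along a path.
∣p─r∣≤∣p─q∣+∣q─r∣ : (p q r : Subset n) → ∣ p ─ r ∣ ≤ ∣ p ─ q ∣ + ∣ q ─ r ∣
∣p─r∣≤∣p─q∣+∣q─r∣ []            []            []            = z≤n
∣p─r∣≤∣p─q∣+∣q─r∣ (x       ∷ p) (inside  ∷ q) (inside  ∷ r) = ∣p─r∣≤∣p─q∣+∣q─r∣ p q r
∣p─r∣≤∣p─q∣+∣q─r∣ (x       ∷ p) (outside ∷ q) (inside  ∷ r) =
  ≤-trans (∣p─r∣≤∣p─q∣+∣q─r∣ p q r) (+-monoˡ-≤ _ (∣p∣≤∣x∷p∣ x (p ─ q)))
∣p─r∣≤∣p─q∣+∣q─r∣ (outside ∷ p) (inside  ∷ q) (outside ∷ r) =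
  ≤-trans (∣p─r∣≤∣p─q∣+∣q─r∣ p q r) (+-monoʳ-≤ ∣ p ─ q ∣ (n≤1+n _))
∣p─r∣≤∣p─q∣+∣q─r∣ (outside ∷ p) (outside ∷ q) (outside ∷ r) = ∣p─r∣≤∣p─q∣+∣q─r∣ p q r
∣p─r∣≤∣p─q∣+∣q─r∣ (inside  ∷ p) (outside ∷ q) (outside ∷ r) = s≤s (∣p─r∣≤∣p─q∣+∣q─r∣ p q r)
∣p─r∣≤∣p─q∣+∣q─r∣ (inside  ∷ p) (inside  ∷ q) (outside ∷ r) =
  ≤-trans (s≤s (∣p─r∣≤∣p─q∣+∣q─r∣ p q r)) (≤-reflexive (sym (+-suc _ _)))

∣p─p∣≡0 : (p : Subset n) → ∣ p ─ p ∣ ≡ 0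
∣p─p∣≡0 []            = refl
∣p─p∣≡0 (outside ∷ p) = ∣p─p∣≡0 p
∣p─p∣≡0 (inside  ∷ p) = ∣p─p∣≡0 p

-- Both differences are what remains of sets of equal size once the common part `p ∩ q` is removed.
∣p─q∣≡∣q─p∣ : (p q : Subset n) → ∣ p ∣ ≡ ∣ q ∣ → ∣ p ─ q ∣ ≡ ∣ q ─ p ∣
∣p─q∣≡∣q─p∣ p q eq = +-cancelˡ-≡ ∣ p ∩ q ∣ _ _ (begin
  ∣ p ∩ q ∣ + ∣ p ─ q ∣  ≡⟨ ∣p∣≡∣p∩q∣+∣p─q∣ p q ⟨
  ∣ p ∣                  ≡⟨ eq ⟩
  ∣ q ∣                  ≡⟨ ∣p∣≡∣p∩q∣+∣p─q∣ q p ⟩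
  ∣ q ∩ p ∣ + ∣ q ─ p ∣  ≡⟨ cong (λ s → ∣ s ∣ + ∣ q ─ p ∣) (∩-comm q p) ⟩
  ∣ p ∩ q ∣ + ∣ q ─ p ∣  ∎)
  where open ≡-Reasoning

x∈p─q⁻ : (p q : Subset n) → ∀ {x} → x ∈ p ─ q → ¬ x ∈ q
x∈p─q⁻ (x ∷ p) (inside ∷ q) () here
x∈p─q⁻ (x ∷ p) (y ∷ q) (there h) (there g) = x∈p─q⁻ p q h g

x∈p⇒0<∣p∣ : ∀ {x} {p : Subset n} → x ∈ p → 0 < ∣ p ∣
x∈p⇒0<∣p∣ {x = x} {p} x∈p = ≤-trans (≤-reflexive (sym (∣⁅x⁆∣≡1 x)))
  (p⊆q⇒∣p∣≤∣q∣ λ y∈⁅x⁆ → subst (_∈ p) (sym (x∈⁅y⁆⇒x≡y x y∈⁅x⁆)) x∈p)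

0<∣p∣⇒Nonempty : (p : Subset n) → 0 < ∣ p ∣ → Nonempty p
0<∣p∣⇒Nonempty {n} p 0<∣p∣ with nonempty? p
... | yes ne   = ne
... | no empty = contradiction
  (trans (cong ∣_∣ (Empty-unique empty)) (∣⊥∣≡0 n)) (>⇒≢ 0<∣p∣)

-- Pigeonhole: `q` and `p ─ q` are disjoint, so together they have at most `n` points, and the
-- excess must come from `p ∩ q`.
n<∣p∣+∣q∣⇒Nonempty[p∩q] : (p q : Subset n) → n < ∣ p ∣ + ∣ q ∣ → Nonempty (p ∩ q)
n<∣p∣+∣q∣⇒Nonempty[p∩q] {n} p q n< = 0<∣p∣⇒Nonempty (p ∩ q)
  (+-cancelʳ-< n 0 _ (begin-strict
    n                                  <⟨ n< ⟩
    ∣ p ∣ + ∣ q ∣                      ≡⟨ cong (_+ ∣ q ∣) (∣p∣≡∣p∩q∣+∣p─q∣ p q) ⟩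
    ∣ p ∩ q ∣ + ∣ p ─ q ∣ + ∣ q ∣      ≡⟨ +-assoc ∣ p ∩ q ∣ _ _ ⟩
    ∣ p ∩ q ∣ + (∣ p ─ q ∣ + ∣ q ∣)    ≡⟨ cong (∣ p ∩ q ∣ +_) (+-comm ∣ p ─ q ∣ _) ⟩
    ∣ p ∩ q ∣ + (∣ q ∣ + ∣ p ─ q ∣)    ≤⟨ +-monoʳ-≤ ∣ p ∩ q ∣ (∣p∣+∣q─p∣≤∣r∣ {p = q} {p} ⊆⊤ ⊆⊤) ⟩
    ∣ p ∩ q ∣ + ∣ ⊤ {n} ∣              ≡⟨ cong (∣ p ∩ q ∣ +_) (∣⊤∣≡n n) ⟩
    ∣ p ∩ q ∣ + n                      ∎))
  where open ≤-Reasoning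

-- Indicator sums, transposes and double counting.

[_]₁ : Bool → ℕ
[ true  ]₁ = 1
[ false ]₁ = 0

∣p∣≡∑ : (p : Subset n) → ∣ p ∣ ≡ sum (λ i → [ lookup p i ]₁)
∣p∣≡∑ []            = refl
∣p∣≡∑ (outside ∷ p) = ∣p∣≡∑ p
∣p∣≡∑ (inside  ∷ p) = cong suc (∣p∣≡∑ p)

sum-mono-≤ : {f g : Fin n → ℕ} → (∀ i → f i ≤ g i) → sum f ≤ sum g
sum-mono-≤ {zero}  f≤g = z≤n
sum-mono-≤ {suc n} f≤g = +-mono-≤ (f≤g zero) (sum-mono-≤ (f≤g ∘ suc))

n*k≤sum : ∀ {k} {f : Fin n → ℕ} → (∀ i → k ≤ f i) → n * k ≤ sum f
n*k≤sum {zero}  k≤f = z≤n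
n*k≤sum {suc n} k≤f = +-mono-≤ (k≤f zero) (n*k≤sum (k≤f ∘ suc))

sum-zero : ∀ n → sum {n} (λ _ → 0) ≡ 0
sum-zero zero    = refl
sum-zero (suc n) = sum-zero n

lookup-transpose-∷ : ∀ {A : Set} {m n} (r : Vec A n) (R : Vec (Vec A n) m) j →
                     lookup (transpose (r ∷ R)) j ≡ lookup r j ∷ lookup (transpose R) j
lookup-transpose-∷ {n = n} r R j = begin
  lookup (replicate n _∷_ ⊛ r ⊛ transpose R) j             ≡⟨ lookup-⊛ j (replicate n _∷_ ⊛ r) (transpose R) ⟩
  lookup (replicate n _∷_ ⊛ r) j (lookup (transpose R) j)
    ≡⟨ cong (λ f → f (lookup (transpose R) j)) (lookup-⊛ j (replicate n _∷_) r) ⟩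
  lookup (replicate n _∷_) j (lookup r j) (lookup (transpose R) j)
    ≡⟨ cong (λ f → f (lookup r j) (lookup (transpose R) j)) (lookup-replicate j _∷_) ⟩
  lookup r j ∷ lookup (transpose R) j                      ∎
  where open ≡-Reasoning

lookup-transpose : ∀ {A : Set} {m n} (R : Vec (Vec A n) m) i j →
                   lookup (lookup (transpose R) j) i ≡ lookup (lookup R i) j
lookup-transpose (r ∷ R) zero    j = cong (λ row → lookup row zero) (lookup-transpose-∷ r R j)
lookup-transpose (r ∷ R) (suc i) j =
  trans (cong (λ row → lookup row (suc i)) (lookup-transpose-∷ r R j)) (lookup-transpose R i j)

-- Counts the arcs (γ, δ) of `R` with δ in `p`: each of the `n` rows γ contributes at least `k`, and
-- each column δ in `p` at most `l`.
double-counting : ∀ {k l} (R : Relation n) (p : Subset n) →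
                  (∀ γ → k ≤ ∣ p ∩ lookup R γ ∣) → (∀ δ → ∣ lookup (R *ᴿ) δ ∣ ≤ l) →
                  n * k ≤ ∣ p ∣ * l
double-counting {n} {k} {l} R p k≤ ≤l = begin
  n * k                                                       ≤⟨ n*k≤sum k≤ ⟩
  sum (λ γ → ∣ p ∩ lookup R γ ∣)
    ≡⟨ sum-cong-≗ (λ γ → trans (∣p∣≡∑ (p ∩ lookup R γ)) (sum-cong-≗ λ δ → cong [_]₁ (entry γ δ))) ⟩
  sum (λ γ → sum λ δ → [ lookup p δ ∧ lookup (lookup (R *ᴿ) δ) γ ]₁)
    ≡⟨ ∑-comm (λ γ δ → [ lookup p δ ∧ lookup (lookup (R *ᴿ) δ) γ ]₁) ⟩
  sum (λ δ → sum λ γ → [ lookup p δ ∧ lookup (lookup (R *ᴿ) δ) γ ]₁)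
    ≤⟨ sum-mono-≤ (λ δ → column (lookup p δ) δ) ⟩
  sum (λ δ → [ lookup p δ ]₁ * l)                             ≡⟨ *-distribʳ-sum l (λ δ → [ lookup p δ ]₁) ⟨
  sum (λ δ → [ lookup p δ ]₁) * l                             ≡⟨ cong (_* l) (∣p∣≡∑ p) ⟨
  ∣ p ∣ * l                                                   ∎
  where
  open ≤-Reasoning

  entry : ∀ γ δ → lookup (p ∩ lookup R γ) δ ≡ lookup p δ ∧ lookup (lookup (R *ᴿ) δ) γ
  entry γ δ = trans (lookup-zipWith _∧_ δ p (lookup R γ))
                    (cong (lookup p δ ∧_) (sym (lookup-transpose R γ δ)))

  column : ∀ b δ → sum (λ γ → [ b ∧ lookup (lookup (R *ᴿ) δ) γ ]₁) ≤ [ b ]₁ * l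
  column false δ = ≤-reflexive (sum-zero n)
  column true  δ = begin
    sum (λ γ → [ lookup (lookup (R *ᴿ) δ) γ ]₁)  ≡⟨ ∣p∣≡∑ (lookup (R *ᴿ) δ) ⟨
    ∣ lookup (R *ᴿ) δ ∣                          ≤⟨ ≤l δ ⟩
    l                                            ≡⟨ *-identityˡ l ⟨
    1 * l                                        ∎

-- Arcs of converses, unions and composites.

*ᴿ-involutive : (R : Relation n) → R *ᴿ *ᴿ ≡ R
*ᴿ-involutive R = ext λ α → ext λ β →
  trans (lookup-transpose (R *ᴿ) β α) (lookup-transpose R α β)
  where
  ext : ∀ {A : Set} {k} {xs ys : Vec A k} → (∀ i → lookup xs i ≡ lookup ys i) → xs ≡ ys
  ext {xs = xs} {ys} eq =
    trans (sym (tabulate∘lookup xs)) (trans (tabulate-cong eq) (tabulate∘lookup ys))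

Arc-* : (R : Relation n) → ∀ {α β} → Arc R α β → Arc (R *ᴿ) β α
Arc-* R {α} {β} h =
  lookup⇒[]= α _ (trans (lookup-transpose R α β) ([]=⇒lookup h))

Arc-*⁻ : (R : Relation n) → ∀ {α β} → Arc (R *ᴿ) α β → Arc R β α
Arc-*⁻ R h = subst (λ T → Arc T _ _) (*ᴿ-involutive R) (Arc-* (R *ᴿ) h)

Arc-1ᴿ : (α : Fin n) → Arc 1ᴿ α α
Arc-1ᴿ α = subst (α ∈_) (sym (lookup∘tabulate ⁅_⁆ α)) (x∈⁅x⁆ α)

Arc-1ᴿ⁻ : {α β : Fin n} → Arc 1ᴿ α β → β ≡ α
Arc-1ᴿ⁻ {α = α} h = x∈⁅y⁆⇒x≡y α (subst (_ ∈_) (lookup∘tabulate ⁅_⁆ α) h)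

Arc-∪⁺ : (R T : Relation n) → ∀ {α β} → Arc R α β ⊎ Arc T α β → Arc (R ∪ᴿ T) α β
Arc-∪⁺ R T {α} h = subst (_ ∈_) (sym (lookup-zipWith Subset._∪_ α R T)) (x∈p∪q⁺ h)

Arc-∪⁻ : (R T : Relation n) → ∀ {α β} → Arc (R ∪ᴿ T) α β → Arc R α β ⊎ Arc T α β
Arc-∪⁻ R T {α} h = x∈p∪q⁻ _ _ (subst (_ ∈_) (lookup-zipWith Subset._∪_ α R T) h)

-- Composition of relations. The set of midpoints is written as in `#paths`, so that coherence
-- applies to it directly.
infixr 7 _⨾_
_⨾_ : Relation n → Relation n → Relation n
R ⨾ T = tabulate λ α → tabulate λ β → does (nonempty? (lookup R α ∩ lookup (T *ᴿ) β))

module _ (R T : Relation n) where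

  private
    entry : ∀ α β → lookup (lookup (R ⨾ T) α) β ≡ does (nonempty? (lookup R α ∩ lookup (T *ᴿ) β))
    entry α β = trans (cong (λ row → lookup row β) (lookup∘tabulate _ α)) (lookup∘tabulate _ β)

  Arc-⨾⁺ : ∀ {α γ β} → Arc R α γ → Arc T γ β → Arc (R ⨾ T) α β
  Arc-⨾⁺ {α} {γ} {β} h g =
    lookup⇒[]= β _ (trans (entry α β) (dec-true (nonempty? _) (γ , x∈p∩q⁺ (h , Arc-* T g))))

  Arc-⨾⁻ : ∀ {α β} → Arc (R ⨾ T) α β → ∃[ γ ] (Arc R α γ × Arc T γ β)
  Arc-⨾⁻ {α} {β} h
    with nonempty? (lookup R α ∩ lookup (T *ᴿ) β) | trans (sym (entry α β)) ([]=⇒lookup h)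
  ... | yes (γ , γ∈) | _ =
    let γ∈R , γ∈T = x∈p∩q⁻ (lookup R α) _ γ∈ in γ , γ∈R , Arc-*⁻ T γ∈T
  ... | no _         | ()

-- Directed balls, shortest paths and the directed diameter.

-- Row α is the out-ball of radius r around α. All radii are built from `1ᴿ`, unions and
-- composition, the operations that preserve unions of classes.
ball : Relation n → ℕ → Relation n
ball a zero    = 1ᴿ
ball a (suc r) = 1ᴿ ∪ᴿ (a ⨾ ball a r)

module _ (a : Relation n) where

  ball⇒path : ∀ r {α β} → Arc (ball a r) α β → Σ[ p ∈ Path a α β ] length p ≤ r
  ball⇒path zero    h with refl ← Arc-1ᴿ⁻ h = ε , z≤n
  ball⇒path (suc r) h with Arc-∪⁻ 1ᴿ (a ⨾ ball a r) h
  ... | inj₁ h₁ with refl ← Arc-1ᴿ⁻ h₁ = ε , z≤n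
  ... | inj₂ h₂ =
    let γ , α→γ , γ↝β = Arc-⨾⁻ a (ball a r) h₂
        p , ∣p∣≤r     = ball⇒path r γ↝β
    in α→γ ◅ p , s≤s ∣p∣≤r

  path⇒ball : ∀ r {α β} (p : Path a α β) → length p ≤ r → Arc (ball a r) α β
  path⇒ball zero    ε       _         = Arc-1ᴿ _
  path⇒ball (suc r) ε       _         = Arc-∪⁺ 1ᴿ (a ⨾ ball a r) (inj₁ (Arc-1ᴿ _))
  path⇒ball (suc r) (h ◅ p) (s≤s p≤r) =
    Arc-∪⁺ 1ᴿ (a ⨾ ball a r) (inj₂ (Arc-⨾⁺ a (ball a r) h (path⇒ball r p p≤r)))

  ball-mono : ∀ {r s α} → r ≤ s → lookup (ball a r) α ⊆ lookup (ball a s) α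
  ball-mono {r} {s} r≤s h = let p , p≤r = ball⇒path r h in path⇒ball s p (≤-trans p≤r r≤s)

  -- Descent on the length bound: membership in a ball is decidable, so either there is a path of
  -- length at most r to continue with, or every path has length at least r + 1 and `p` is shortest.
  shortest : ∀ r {α β} (p : Path a α β) → length p ≤ r → Σ[ q ∈ Path a α β ] Shortest q
  shortest zero    p p≤r = p , λ q → ≤-trans p≤r z≤n
  shortest (suc r) {α} {β} p p≤r with β ∈? lookup (ball a r) α
  ... | yes h = let q , q≤r = ball⇒path r h in shortest r q q≤r
  ... | no ¬h = p , λ q → ≤-trans p≤r (≰⇒> λ q≤r → ¬h (path⇒ball r q q≤r))

  directed-diameter : Fin n → (∀ α β → Path a α β) → ∃[ D ] IsDirectedDiameter a D
  directed-diameter ω paths = length (path top) ,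
    (λ α β → path (α , β) , is-shortest (α , β) ,
             All.lookup (f[xs]≤f[argmax] (ω , ω) pairs)
                        (∈-cartesianProduct⁺ (∈-allFin α) (∈-allFin β))) ,
    proj₁ top , proj₂ top , path top , is-shortest top , refl
    where
    path : ((α , β) : Fin n × Fin n) → Path a α β
    path (α , β) = proj₁ (shortest _ (paths α β) ≤-refl)

    is-shortest : ∀ αβ → Shortest (path αβ)
    is-shortest (α , β) = proj₂ (shortest _ (paths α β) ≤-refl)

    pairs : List (Fin n × Fin n)
    pairs = cartesianProduct (allFin n) (allFin n)

    top : Fin n × Fin n
    -- `argmax` takes a default element; the given vertex `ω` supplies it.
    top = argmax (length ∘ path) (ω , ω) pairs

length-◅◅ : ∀ {A : Set} {R : A → A → Set} {x y z} (p : Star R x y) (q : Star R y z) →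
            length (p ◅◅ q) ≡ length p + length q
length-◅◅ ε       q = refl
length-◅◅ (h ◅ p) q = cong suc (length-◅◅ p q)

-- Invariant relations of a scheme and their valencies.

module _ (X : Scheme n) where
  open Scheme X

  -- The property of being a union of classes, put arcwise so that no list of classes has to be
  -- carried through unions, converses and composites.
  Invariant : Relation n → Set
  Invariant R = ∀ {c α β α′ β′} → S c → Arc c α β → Arc c α′ β′ → Arc R α β → Arc R α′ β′

  class-invariant : ∀ {c} → S c → Invariant c
  class-invariant Sc Sc′ h h′ g with refl ← disjoint Sc′ Sc h g = h′

  ∪-invariant : ∀ R T → Invariant R → Invariant T → Invariant (R ∪ᴿ T)
  ∪-invariant R T inv-R inv-T Sc h h′ g with Arc-∪⁻ R T g
  ... | inj₁ g₁ = Arc-∪⁺ R T (inj₁ (inv-R Sc h h′ g₁))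
  ... | inj₂ g₂ = Arc-∪⁺ R T (inj₂ (inv-T Sc h h′ g₂))

  *-invariant : ∀ R → Invariant R → Invariant (R *ᴿ)
  *-invariant R inv-R {c} Sc h h′ g =
    Arc-* R (inv-R (*ᴿ-closed Sc) (Arc-* c h) (Arc-* c h′) (Arc-*⁻ R g))

  -- Take the classes `b` and `e` of the two arcs through a midpoint γ. The number of such midpoints
  -- is positive for (α, β), hence by coherence also for (α′, β′), and invariance of `R` and `T`
  -- carries the two arcs over.
  ⨾-invariant : ∀ R T → Invariant R → Invariant T → Invariant (R ⨾ T)
  ⨾-invariant R T inv-R inv-T {c} {α} {β} {α′} {β′} Sc h h′ g =
    let γ , α→γ , γ→β       = Arc-⨾⁻ R T g
        b , Sb , b[α,γ]     = cover α γ
        e , Se , e[γ,β]     = cover γ β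
        0<#                 = x∈p⇒0<∣p∣ {p = lookup b α ∩ lookup (e *ᴿ) β} (x∈p∩q⁺ (b[α,γ] , Arc-* e e[γ,β]))
        γ′ , γ′∈            = 0<∣p∣⇒Nonempty (lookup b α′ ∩ lookup (e *ᴿ) β′)
                                (subst (0 <_) (coherent Sc Sb Se h h′) 0<#)
        b[α′,γ′] , e*[β′,γ′] = x∈p∩q⁻ (lookup b α′) _ γ′∈
    in Arc-⨾⁺ R T (inv-R Sb b[α,γ] b[α′,γ′] α→γ)
                  (inv-T Se e[γ,β] (Arc-*⁻ e e*[β′,γ′]) γ→β)

  ^∪-invariant : ∀ {a} → a ∈ X ^∪ → Invariant a
  ^∪-invariant (T , ST , refl) = go T ST
    where
    go : ∀ T → All S T → Invariant (⋃ᴿ T)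
    go List.[]      _               {α = α} _ _ _ g =
      contradiction (subst (_ ∈_) (lookup-replicate α ⊥) g) ∉⊥
    go (c List.∷ T) (Sc All.∷ ST) = ∪-invariant c (⋃ᴿ T) (class-invariant Sc) (go T ST)

  ball-invariant : ∀ a → Invariant a → ∀ r → Invariant (ball a r)
  ball-invariant a inv zero    = class-invariant 1ᴿ-class
  ball-invariant a inv (suc r) =
    ∪-invariant 1ᴿ (a ⨾ ball a r) (class-invariant 1ᴿ-class)
      (⨾-invariant a (ball a r) inv (ball-invariant a inv r))

  -- The valency at γ counts the paths γ → δ → γ with arcs in `c` and `c *ᴿ`. All pairs (γ, γ) lie
  -- in the single class `1ᴿ`, so coherence makes the count constant.
  class-valency : ∀ {c} → S c → ∀ α β → ∣ lookup c α ∣ ≡ ∣ lookup c β ∣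
  class-valency {c} Sc α β = begin
    ∣ lookup c α ∣          ≡⟨ #paths-c-c* α ⟨
    #paths c (c *ᴿ) α α     ≡⟨ coherent 1ᴿ-class Sc (*ᴿ-closed Sc) (Arc-1ᴿ α) (Arc-1ᴿ β) ⟩
    #paths c (c *ᴿ) β β     ≡⟨ #paths-c-c* β ⟩
    ∣ lookup c β ∣          ∎
    where
    open ≡-Reasoning
    #paths-c-c* : ∀ γ → #paths c (c *ᴿ) γ γ ≡ ∣ lookup c γ ∣
    #paths-c-c* γ = trans (cong (λ e → ∣ lookup c γ ∩ lookup e γ ∣) (*ᴿ-involutive c))
                          (cong ∣_∣ (∩-idem (lookup c γ)))

  -- S comes without an enumeration, so the classes contained in R are split off
  -- one at a time; k bounds the number of points left in row α.
  valency-≤ : ∀ R → Invariant R → ∀ α β → ∣ lookup R α ∣ ≤ ∣ lookup R β ∣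
  valency-≤ R inv α β = go _ R inv ≤-refl
    where
    open ≤-Reasoning
    go : ∀ k R → Invariant R → ∣ lookup R α ∣ ≤ k → ∣ lookup R α ∣ ≤ ∣ lookup R β ∣
    go zero    R inv ≤0 = ≤-trans ≤0 z≤n
    go (suc k) R inv ≤k with nonempty? (lookup R α)
    ... | no empty = begin
      ∣ lookup R α ∣  ≡⟨ cong ∣_∣ (Empty-unique empty) ⟩
      ∣ ⊥ {n} ∣       ≡⟨ ∣⊥∣≡0 n ⟩
      0               ≤⟨ z≤n ⟩
      ∣ lookup R β ∣  ∎
    ... | yes (δ , R[α,δ]) = begin
      ∣ lookup R α ∣                                     ≡⟨ split α ⟩
      ∣ lookup c α ∣ + ∣ lookup R∖c α ∣                  ≤⟨ +-mono-≤ (≤-reflexive (class-valency Sc α β))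
                                                                     (go k R∖c R∖c-invariant smaller) ⟩
      ∣ lookup c β ∣ + ∣ lookup R∖c β ∣                  ≡⟨ split β ⟨
      ∣ lookup R β ∣                                     ∎
      where
      c : Relation n
      c = proj₁ (cover α δ)

      Sc : S c
      Sc = proj₁ (proj₂ (cover α δ))

      c[α,δ] : Arc c α δ
      c[α,δ] = proj₂ (proj₂ (cover α δ))

      R∖c : Relation n
      R∖c = zipWith _─_ R c

      row : ∀ γ → lookup R∖c γ ≡ lookup R γ ─ lookup c γ
      row γ = lookup-zipWith _─_ γ R c

      c⊆R : ∀ γ → lookup c γ ⊆ lookup R γ
      c⊆R γ c[γ,x] = inv Sc c[α,δ] c[γ,x] R[α,δ]

      R∩c : ∀ γ → lookup R γ ∩ lookup c γ ≡ lookup c γ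
      R∩c γ = ⊆-antisym (p∩q⊆q (lookup R γ) (lookup c γ)) λ h → x∈p∩q⁺ (c⊆R γ h , h)

      split : ∀ γ → ∣ lookup R γ ∣ ≡ ∣ lookup c γ ∣ + ∣ lookup R∖c γ ∣
      split γ = trans (∣p∣≡∣p∩q∣+∣p─q∣ (lookup R γ) (lookup c γ))
                      (cong₂ (λ p q → ∣ p ∣ + ∣ q ∣) (R∩c γ) (sym (row γ)))

      R∖c-invariant : Invariant R∖c
      R∖c-invariant Sb h h′ g =
        let g′ = subst (_ ∈_) (row _) g in
        subst (_ ∈_) (sym (row _))
          (x∈p∧x∉q⇒x∈p─q (inv Sb h h′ (p─q⊆p _ _ g′))
                         (λ c[h′] → x∈p─q⁻ _ _ g′ (class-invariant Sc Sb h′ h c[h′])))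

      smaller : ∣ lookup R∖c α ∣ ≤ k
      smaller = ≤-pred (begin
        suc ∣ lookup R∖c α ∣               ≡⟨ cong (suc ∘ ∣_∣) (row α) ⟩
        suc ∣ lookup R α ─ lookup c α ∣    ≤⟨ p∩q≢∅⇒∣p─q∣<∣p∣ (lookup R α) (lookup c α)
                                                (δ , x∈p∩q⁺ (R[α,δ] , c[α,δ])) ⟩
        ∣ lookup R α ∣                     ≤⟨ ≤k ⟩
        suc k                              ∎)

  valency : ∀ R → Invariant R → ∀ α β → ∣ lookup R α ∣ ≡ ∣ lookup R β ∣
  valency R inv α β = ≤-antisym (valency-≤ R inv α β) (valency-≤ R inv β α)

  -- Both valencies are constant, and `n` times either one is the total number of arcs of `R`.
  in-valency-≤ : ∀ R → Invariant R → ∀ α β → ∣ lookup (R *ᴿ) α ∣ ≤ ∣ lookup R β ∣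
  in-valency-≤ R inv α β = *-cancelˡ-≤ n {{nonZeroIndex α}} (begin
    n * ∣ lookup (R *ᴿ) α ∣          ≤⟨ double-counting (R *ᴿ) ⊤ (λ γ → ≤-reflexive (out γ))
                                         (λ δ → ≤-reflexive (in′ δ)) ⟩
    ∣ ⊤ {n} ∣ * ∣ lookup R β ∣       ≡⟨ cong (_* ∣ lookup R β ∣) (∣⊤∣≡n n) ⟩
    n * ∣ lookup R β ∣               ∎)
    where
    open ≤-Reasoning
    out : ∀ γ → ∣ lookup (R *ᴿ) α ∣ ≡ ∣ ⊤ ∩ lookup (R *ᴿ) γ ∣
    out γ = trans (valency (R *ᴿ) (*-invariant R inv) α γ) (cong ∣_∣ (sym (∩-identityˡ (lookup (R *ᴿ) γ))))

    in′ : ∀ δ → ∣ lookup (R *ᴿ *ᴿ) δ ∣ ≡ ∣ lookup R β ∣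
    in′ δ = trans (cong (λ T → ∣ lookup T δ ∣) (*ᴿ-involutive R)) (valency R inv δ β)

  in-valency-≥ : ∀ R → Invariant R → ∀ α β → ∣ lookup R β ∣ ≤ ∣ lookup (R *ᴿ) α ∣
  in-valency-≥ R inv α β =
    subst (λ T → ∣ lookup T β ∣ ≤ ∣ lookup (R *ᴿ) α ∣) (*ᴿ-involutive R)
          (in-valency-≤ (R *ᴿ) (*-invariant R inv) β α)

-- Binary logarithms.

floor-log₂ : ∀ n → 0 < n → ∃[ k ] (2 ^ k ≤ n × n < 2 ^ suc k)
floor-log₂ (suc zero)    _ = 0 , ≤-refl , s≤s (s≤s z≤n)
floor-log₂ (suc n@(suc _)) _ with floor-log₂ n (s≤s z≤n)
... | k , 2^k≤n , n<2^1+k with m≤n⇒m<n∨m≡n n<2^1+k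
...   | inj₁ 1+n<2^1+k = k , m≤n⇒m≤1+n 2^k≤n , 1+n<2^1+k
-- The successor is itself a power of 2, so the exponent moves up by one.
...   | inj₂ 1+n≡2^1+k = suc k , ≤-reflexive (sym 1+n≡2^1+k) ,
  subst (_< 2 ^ suc (suc k)) (sym 1+n≡2^1+k) (^-monoʳ-< 2 (s≤s (s≤s z≤n)) (n<1+n (suc k)))

^-cancelʳ-≤ : ∀ m {n o} → 1 < m → m ^ n ≤ m ^ o → n ≤ o
^-cancelʳ-≤ m 1<m m^n≤m^o = ≮⇒≥ λ o<n → <⇒≱ (^-monoʳ-< m 1<m o<n) m^n≤m^o

n≤n^2 : ∀ n → n ≤ n ^ 2
n≤n^2 zero    = z≤n
n≤n^2 (suc n) = m≤m*n (suc n) (suc n ^ 1) {{m^n≢0 (suc n) 1}}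

-- Here `2 ^ k ≤ n` gives `k * q ≤ p`, that is, k is at most log n. The hypothesis on `D` is linear
-- in d and k; each factor is then weakened to its square.
≤·log₂²-bound : ∀ D d k → 2 ^ k ≤ n → D ≤ 2 * (k * (2 * d)) → D ≤ 4 * d ^ 2 ·log₂² n
≤·log₂²-bound {n} D d k 2^k≤n D≤ p q n^q≤2^p = begin
  D * q ^ 2                           ≤⟨ *-monoˡ-≤ (q ^ 2) D≤ ⟩
  2 * (k * (2 * d)) * q ^ 2           ≡⟨ rearrange k d (q ^ 2) ⟩
  4 * d * (k * q ^ 2)                 ≤⟨ *-mono-≤ (*-monoʳ-≤ 4 (n≤n^2 d)) (*-monoˡ-≤ (q ^ 2) (n≤n^2 k)) ⟩
  4 * d ^ 2 * (k ^ 2 * q ^ 2)         ≡⟨ cong (4 * d ^ 2 *_) (square k q) ⟨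
  4 * d ^ 2 * (k * q) ^ 2             ≤⟨ *-monoʳ-≤ (4 * d ^ 2) (^-monoˡ-≤ 2 kq≤p) ⟩
  4 * d ^ 2 * p ^ 2                   ∎
  where
  open ≤-Reasoning

  rearrange : ∀ k d s → 2 * (k * (2 * d)) * s ≡ 4 * d * (k * s)
  rearrange = solve-∀

  square : ∀ k q → k * q * (k * q * 1) ≡ k * (k * 1) * (q * (q * 1))
  square = solve-∀

  kq≤p : k * q ≤ p
  kq≤p = ^-cancelʳ-≤ 2 (s≤s (s≤s z≤n)) (begin
    2 ^ (k * q)    ≡⟨ ^-*-assoc 2 k q ⟨
    (2 ^ k) ^ q    ≤⟨ ^-monoˡ-≤ q 2^k≤n ⟩
    n ^ q          ≤⟨ n^q≤2^p ⟩
    2 ^ p          ∎)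

-- Growth of the directed balls.

module Growth (X : Scheme n) {a : Relation n} (inv : Invariant X a) {d : ℕ}
              (paths : ∀ α β → Σ[ p ∈ Path (a ∪ᴿ a *ᴿ) α β ] length p ≤ d)
              (ω : Fin n) where

  B : Fin n → ℕ → Subset n
  B α r = lookup (ball a r) α

  b : ℕ → ℕ
  b r = ∣ B ω r ∣

  ∣B∣≡b : ∀ α r → ∣ B α r ∣ ≡ b r
  ∣B∣≡b α r = valency X (ball a r) (ball-invariant X a inv r) α ω

  0<b : ∀ r → 0 < b r
  0<b r = x∈p⇒0<∣p∣ (path⇒ball a r {ω} ε z≤n)

  b-mono : ∀ {r s} → r ≤ s → b r ≤ b s
  b-mono r≤s = p⊆q⇒∣p∣≤∣q∣ (ball-mono a r≤s)

  module _ (r : ℕ) where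
    open ≤-Reasoning

    e : ℕ
    e = b (suc r) ∸ b r

    arc-─ : ∀ {α β} → Arc a α β → ∣ B β r ─ B α r ∣ ≤ e
    arc-─ {α} {β} α→β = m+n≤o⇒m≤o∸n ∣ B β r ─ B α r ∣ (begin
      ∣ B β r ─ B α r ∣ + b r          ≡⟨ +-comm _ (b r) ⟩
      b r + ∣ B β r ─ B α r ∣          ≡⟨ cong (_+ ∣ B β r ─ B α r ∣) (∣B∣≡b α r) ⟨
      ∣ B α r ∣ + ∣ B β r ─ B α r ∣    ≤⟨ ∣p∣+∣q─p∣≤∣r∣ (ball-mono a {r} (n≤1+n r)) B-β⊆ ⟩
      ∣ B α (suc r) ∣                  ≡⟨ ∣B∣≡b α (suc r) ⟩
      b (suc r)                        ∎)
      where
      B-β⊆ : B β r ⊆ B α (suc r)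
      B-β⊆ h = let p , p≤r = ball⇒path a r h in path⇒ball a (suc r) (α→β ◅ p) (s≤s p≤r)

    ∪-arc-─ : ∀ {α β} → Arc (a ∪ᴿ a *ᴿ) α β → ∣ B α r ─ B β r ∣ ≤ e
    ∪-arc-─ {α} {β} h with Arc-∪⁻ a (a *ᴿ) h
    -- `arc-─` bounds the opposite difference; the balls have equal size, so the two differences do
    -- too.
    ... | inj₁ α→β = ≤-trans
      (≤-reflexive (∣p─q∣≡∣q─p∣ (B α r) (B β r) (trans (∣B∣≡b α r) (sym (∣B∣≡b β r)))))
      (arc-─ α→β)
    ... | inj₂ β→α = arc-─ (Arc-*⁻ a β→α)

    path-─ : ∀ {α β} (p : Path (a ∪ᴿ a *ᴿ) α β) → ∣ B α r ─ B β r ∣ ≤ length p * e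
    path-─ {α} ε = ≤-reflexive (∣p─p∣≡0 (B α r))
    path-─ {α} {β} (_◅_ {j = γ} h p) = begin
      ∣ B α r ─ B β r ∣                        ≤⟨ ∣p─r∣≤∣p─q∣+∣q─r∣ (B α r) (B γ r) (B β r) ⟩
      ∣ B α r ─ B γ r ∣ + ∣ B γ r ─ B β r ∣    ≤⟨ +-mono-≤ (∪-arc-─ h) (path-─ p) ⟩
      e + length p * e                         ∎

    ∩-large : ∀ β → b r ∸ d * e ≤ ∣ B ω r ∩ B β r ∣
    ∩-large β = m≤n+o⇒m∸n≤o (b r) (d * e) (begin
      b r                                      ≡⟨ ∣p∣≡∣p∩q∣+∣p─q∣ (B ω r) (B β r) ⟩
      ∣ B ω r ∩ B β r ∣ + ∣ B ω r ─ B β r ∣    ≡⟨ +-comm ∣ B ω r ∩ B β r ∣ _ ⟩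
      ∣ B ω r ─ B β r ∣ + ∣ B ω r ∩ B β r ∣    ≤⟨ +-monoˡ-≤ _ (≤-trans (path-─ p) (*-monoˡ-≤ e p≤d)) ⟩
      d * e + ∣ B ω r ∩ B β r ∣                ∎)
      where
      p   = proj₁ (paths ω β)
      p≤d = proj₂ (paths ω β)

    -- Every ball of radius r meets `B ω r` in at least m = b - d e points. Double counting gives n
    -- m ≤ b², so 2 b ≤ n forces 2 m ≤ b, and 2 b ≤ 2 d e + 2 m leaves b ≤ 2 d e.
    b≤2de : 2 * b r ≤ n → b r ≤ 2 * (d * e)
    b≤2de 2b≤n = +-cancelˡ-≤ (b r) _ _ (begin
      b r + b r                              ≡⟨ cong (b r +_) (+-identityʳ (b r)) ⟨
      -- This holds also when the subtraction in `m` is truncated to 0.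
      2 * b r                                ≤⟨ *-monoʳ-≤ 2 (m≤n+m∸n (b r) (d * e)) ⟩
      2 * (d * e + m)                        ≡⟨ *-distribˡ-+ 2 (d * e) m ⟩
      2 * (d * e) + 2 * m                    ≤⟨ +-monoʳ-≤ (2 * (d * e)) 2m≤b ⟩
      2 * (d * e) + b r                      ≡⟨ +-comm (2 * (d * e)) (b r) ⟩
      b r + 2 * (d * e)                      ∎)
      where
      m : ℕ
      m = b r ∸ d * e

      2m≤b : 2 * m ≤ b r
      2m≤b = *-cancelˡ-≤ (b r) {{>-nonZero (0<b r)}} (begin
        b r * (2 * m)    ≡⟨ *-assoc (b r) 2 m ⟨
        b r * 2 * m      ≡⟨ cong (_* m) (*-comm (b r) 2) ⟩
        2 * b r * m      ≤⟨ *-monoˡ-≤ m 2b≤n ⟩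
        n * m            ≤⟨ double-counting (ball a r) (B ω r) ∩-large
                              -- A column of `ball a r` is an in-ball, which has at most `b r`
                              -- points.
                              (λ δ → in-valency-≤ X (ball a r) (ball-invariant X a inv r) δ ω) ⟩
        b r * b r        ∎)

    -- One step enlarges the ball by a factor of at least 1 + 1 / (2 d), written without
    -- denominators so that it also makes sense for d = 0.
    growth : 2 * b r ≤ n → 2 * d * b r + b r ≤ 2 * d * b (suc r)
    growth 2b≤n = begin
      2 * d * b r + b r            ≤⟨ +-monoʳ-≤ (2 * d * b r) (b≤2de 2b≤n) ⟩
      2 * d * b r + 2 * (d * e)    ≡⟨ cong (2 * d * b r +_) (*-assoc 2 d e) ⟨
      2 * d * b r + 2 * d * e      ≡⟨ *-distribˡ-+ (2 * d) (b r) e ⟨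
      2 * d * (b r + e)            ≡⟨ cong (2 * d *_) (m+[n∸m]≡n (b-mono (n≤1+n r))) ⟩
      2 * d * b (suc r)            ∎

  open ≤-Reasoning

  -- Until a ball exceeds half of the points, each step adds at least the (2 d)-th part of the
  -- current size, hence at least that part of the initial `b r`.
  linear-growth : ∀ r j → n < 2 * b (j + r) ⊎ 2 * d * b r + j * b r ≤ 2 * d * b (j + r)
  linear-growth r zero    = inj₂ (≤-reflexive (+-identityʳ _))
  linear-growth r (suc j) with linear-growth r j | 2 * b (j + r) ≤? n
  ... | inj₁ n<2b | _        = inj₁ (<-≤-trans n<2b (*-monoʳ-≤ 2 (b-mono (n≤1+n (j + r)))))
  ... | inj₂ _    | no 2b≰n  = inj₁ (<-≤-trans (≰⇒> 2b≰n) (*-monoʳ-≤ 2 (b-mono (n≤1+n (j + r)))))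
  ... | inj₂ IH   | yes 2b≤n = inj₂ (begin
    2 * d * b r + (b r + j * b r)    ≡⟨ cong (2 * d * b r +_) (+-comm (b r) _) ⟩
    2 * d * b r + (j * b r + b r)    ≡⟨ +-assoc (2 * d * b r) _ _ ⟨
    2 * d * b r + j * b r + b r      ≤⟨ +-mono-≤ IH (b-mono (m≤n+m r j)) ⟩
    2 * d * b (j + r) + b (j + r)    ≤⟨ growth (j + r) 2b≤n ⟩
    2 * d * b (suc j + r)            ∎)

  doubling : ∀ r → n < 2 * b (2 * d + r) ⊎ 2 * b r ≤ b (2 * d + r)
  doubling r with linear-growth r (2 * d) | d ≟ 0 | 2 * b r ≤? n
  ... | inj₁ n<2b | _       | _        = inj₁ n<2b
  -- After 2 d steps the accumulated gain equals the initial size, and the factor 2 d cancels.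
  ... | inj₂ h    | no d≢0  | _        = inj₂ (*-cancelˡ-≤ (2 * d) {{2d-nonZero}} (begin
    2 * d * (2 * b r)              ≡⟨ split (2 * d) (b r) ⟩
    2 * d * b r + 2 * d * b r      ≤⟨ h ⟩
    2 * d * b (2 * d + r)          ∎))
    where
    2d-nonZero = m*n≢0 2 d {{_}} {{≢-nonZero d≢0}}

    split : ∀ k m → k * (2 * m) ≡ k * m + k * m
    split = solve-∀
  ... | inj₂ _    | yes d≡0 | no 2b≰n  =
    inj₁ (<-≤-trans (≰⇒> 2b≰n) (*-monoʳ-≤ 2 (b-mono (m≤n+m r (2 * d)))))
  -- With d = 0 and at most half of the points covered, `b≤2de` would make the ball empty.
  ... | inj₂ _    | yes d≡0 | yes 2b≤n = contradiction b≤0 (<⇒≱ (0<b r))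
    where
    b≤0 : b r ≤ 0
    b≤0 = begin
      b r              ≤⟨ b≤2de r 2b≤n ⟩
      2 * (d * e r)    ≡⟨ cong (λ d → 2 * (d * e r)) d≡0 ⟩
      0                ∎

  exponential-growth : ∀ k → n < 2 * b (k * (2 * d)) ⊎ 2 ^ k ≤ b (k * (2 * d))
  exponential-growth zero    = inj₂ (0<b 0)
  exponential-growth (suc k) with exponential-growth k | doubling (k * (2 * d))
  ... | inj₁ n<2b | _         =
    inj₁ (<-≤-trans n<2b (*-monoʳ-≤ 2 (b-mono (m≤n+m (k * (2 * d)) (2 * d)))))
  ... | inj₂ _    | inj₁ n<2b = inj₁ n<2b
  ... | inj₂ 2^k≤ | inj₂ 2b≤  = inj₂ (≤-trans (*-monoʳ-≤ 2 2^k≤) 2b≤)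

  majority : ∀ k → n < 2 ^ suc k → n < 2 * b (k * (2 * d))
  majority k n< with exponential-growth k
  ... | inj₁ n<2b = n<2b
  ... | inj₂ 2^k≤ = <-≤-trans n< (*-monoʳ-≤ 2 2^k≤)

  -- The out-ball of α and the in-ball of β each contain more than half of the points, so they share
  -- some γ; the path goes through it.
  short-path : ∀ r → n < 2 * b r → ∀ α β → Σ[ p ∈ Path a α β ] length p ≤ 2 * r
  short-path r n<2b α β =
    let γ , γ∈          = n<∣p∣+∣q∣⇒Nonempty[p∩q] (B α r) in-ball (begin-strict
                            n                        <⟨ n<2b ⟩
                            b r + (b r + 0)          ≡⟨ cong (b r +_) (+-identityʳ (b r)) ⟩
                            b r + b r                ≤⟨ +-mono-≤ (≤-reflexive (sym (∣B∣≡b α r)))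
                                                          (in-valency-≥ X (ball a r) (ball-invariant X a inv r) β ω) ⟩
                            ∣ B α r ∣ + ∣ in-ball ∣  ∎)
        γ∈out , γ∈in    = x∈p∩q⁻ (B α r) in-ball γ∈
        p , p≤r         = ball⇒path a r γ∈out
        q , q≤r         = ball⇒path a r (Arc-*⁻ (ball a r) γ∈in)
    in p ◅◅ q , (begin
      length (p ◅◅ q)       ≡⟨ length-◅◅ p q ⟩
      length p + length q   ≤⟨ +-mono-≤ p≤r q≤r ⟩
      r + r                 ≡⟨ cong (r +_) (+-identityʳ r) ⟨
      2 * r                 ∎)
    where
    in-ball : Subset n
    in-ball = lookup (ball a r *ᴿ) β

  directed-diameter-bound : ∃[ D ] (IsDirectedDiameter a D × (D ≤ 4 * d ^ 2 ·log₂² n))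
  directed-diameter-bound =
    let k , 2^k≤n , n<2^1+k              = floor-log₂ n (n>0 ω)
        r                                = k * (2 * d)
        short                            = short-path r (majority k n<2^1+k)
        D , D-diameter                   = directed-diameter a ω (λ α β → proj₁ (short α β))
        -- A pair attaining the diameter: its shortest path has length `D`, so any path between the
        -- two bounds `D`.
        α , β , p , p-shortest , ∣p∣≡D   = proj₂ D-diameter
        q , ∣q∣≤2r                       = short α β
    in D , D-diameter ,
       ≤·log₂²-bound D d k 2^k≤n (subst (_≤ 2 * r) ∣p∣≡D (≤-trans (p-shortest q) ∣q∣≤2r))
    where
    n>0 : ∀ {n} → Fin n → 0 < n
    n>0 zero    = s≤s z≤n
    n>0 (suc _) = s≤s z≤n

-- From connectedness to the bound on the diameter.

connected⇒path : (a : Relation n) → Connected a → ∀ α β → Path (a ∪ᴿ a *ᴿ) α β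
connected⇒path a conn α β = gmap id step (conn α β)
  where
  step : ∀ {α β} → SymClosure (Arc a) α β → Arc (a ∪ᴿ a *ᴿ) α β
  step (fwd h) = Arc-∪⁺ a (a *ᴿ) (inj₁ h)
  step (bwd h) = Arc-∪⁺ a (a *ᴿ) (inj₂ (Arc-* a h))

theorem4p1 : ∃[ C ] (C > 0 ×
    (∀ (n : ℕ) (X : Scheme n) (a : Relation n) → a ∈ X ^∪ → Connected a →
    ∃₂ λ D d → IsDirectedDiameter a D × IsDiameter a d ×
    (D ≤ C * d ^ 2 ·log₂² n)))
theorem4p1 = 4 , s≤s z≤n , λ n X a a∈X^∪ conn →
  -- The constant 4 comes from two paths of length at most 2 d k with k = ⌊log n⌋. A base point
  -- exists because the diagonal is a class and classes are nonempty.
  let ω                          = proj₁ (Scheme.nonempty X (Scheme.1ᴿ-class X))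
      d , d-diameter             = directed-diameter (a ∪ᴿ a *ᴿ) ω (connected⇒path a conn)
      short                      = λ α β → let p , _ , ∣p∣≤d = proj₁ d-diameter α β in p , ∣p∣≤d
      D , D-diameter , D≤        =
        Growth.directed-diameter-bound X {a} (^∪-invariant X a∈X^∪) {d} short ω
  in D , d , D-diameter , d-diameter , D≤
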